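{- Let $\varphi$ be a propositional formula, $V=\mathrm{var}(\varphi)$, and $I\subseteq V$. Then $\langle I,I\rangle$ is an equilibrium model of $\varphi$ if and only if $I'$ is a model of the quantified Boolean formula $$\mathcal{T}_E[\varphi]=\varphi'\wedge\neg\exists V\big((V<V')\wedge\tau[\varphi]\big).$$
   Context: Formulas are built from propositional variables (atoms), the constants $\top,\bot$, and the primitive connectives $\neg,\wedge,\vee,\supset$. $\mathrm{var}(\varphi)$ is the set of variables of $\varphi$. A classical interpretation is a set $I$ of atoms ($p$ is true iff $p\in I$). Priming: for each atom $p$, $p'$ is a globally new atom; $\varphi'$ is obtained from $\varphi$ by replacing every atom $p$ by $p'$; for a set $I$ of atoms, $I'=\{p'\mid p\in I\}$ (likewise $V'$). QBFs extend propositional formulas by quantifiers $\forall p,\exists p$ over atoms: under $I$, $\forall p\,\Psi$ is true iff both $\Psi[p/\top]$ and $\Psi[p/\bot]$ are true, $\exists p\,\Psi$ is true iff at least one is (substituting for free occurrences); other connectives are classical. $I$ is a model of $\Phi$ if $\Phi$ is true under $I$. For $P=\{p_1,\dots,p_n\}$, $\exists P\,\Phi$ means $\exists p_1\cdots\exists p_n\,\Phi$ (similarly $\forall$). For indexed sets $S=\{\varphi_1,\dots,\varphi_n\}$, $T=\{\psi_1,\dots,\psi_n\}$ of formulas, $S\le T$ abbreviates $\bigwedge_{i}(\varphi_i\supset\psi_i)$ and $S<T$ abbreviates $(S\le T)\wedge\neg(T\le S)$; in $V<V'$ the atom $p$ is paired with $p'$. Logic of here-and-there (HT): an HT-interpretation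 is a pair $\mathcal I=\langle I_H,I_T\rangle$ of sets of atoms with $I_H\subseteq I_T$; worlds $H\le T$ (with $\le$ reflexive). Truth in world $w\in\{H,T\}$: $\top$ is true, $\bot$ is false; an atom $p$ is true in $w$ iff $p\in I_w$; $\wedge,\vee$ are evaluated classically in $w$; $\neg\psi$ is true in $w$ iff $\psi$ is false in all $u\ge w$; $\varphi_1\supset\varphi_2$ is true in $w$ iff for all $u\ge w$, $\varphi_1$ is false in $u$ or $\varphi_2$ is true in $u$. $\mathcal I$ is an HT-model of $\varphi$ iff $\varphi$ is true in $H$. An equilibrium model of $\varphi$ is a pair $\langle I,I\rangle$ that is an HT-model of $\varphi$ such that for no proper subset $J\subset I$ is $\langle J,I\rangle$ an HT-model of $\varphi$. The translation $\tau[\cdot]$: $\tau[\varphi]=\varphi$ if $\varphi$ is an atom, $\top$ or $\bot$; $\tau[\varphi_1\circ\varphi_2]=\tau[\varphi_1]\circ\tau[\varphi_2]$ for $\circ\in\{\wedge,\vee\}$; $\tau[\neg\psi]=\neg\psi'$; $\tau[\varphi_1\supset\varphi_2]=(\tau[\varphi_1]\supset\tau[\varphi_2])\wedge(\varphi_1'\supset\varphi_2')$. -}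

module Defs where

open import Data.Bool.Base using (Bool; true; false)
open import Data.Empty using (⊥)
open import Data.List.Base as List using (List; []; _∷_; [_]; _++_; length; deduplicate)
open import Data.Nat.Base using (ℕ; suc; _+_)
open import Data.Product.Base using (_×_; proj₁)
open import Data.Sum.Base using (_⊎_; inj₁; inj₂; [_,_])
open import Data.Sum.Properties using (≡-dec)
open import Data.Unit.Base using (⊤)
open import Data.Vec.Base as Vec using (Vec; zipWith; fromList; foldr′)
open import Function.Base using (id; const)
open import Level using (0ℓ)
open import Relation.Binary.Definitions using (DecidableEquality)
open import Relation.Nullary.Decidable.Core using (yes; no)
open import Relation.Nullary.Negation.Core using (¬_)
open import Relation.Unary using (Pred; _⊆_; _⊂_)

infix  9 ¬ᶠ_
infixr 8 _∧ᶠ_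
infixr 7 _∨ᶠ_
infixr 6 _⊃ᶠ_

data Formula (A : Set) : Set where
  atom           : A → Formula A
  ⊤ᶠ ⊥ᶠ          : Formula A
  ¬ᶠ_            : Formula A → Formula A
  _∧ᶠ_ _∨ᶠ_ _⊃ᶠ_ : Formula A → Formula A → Formula A

------------------------------------------------------------------------
-- Quantified Boolean formulas

-- The index bounds the depth of quantifier nesting; QBF X 0 has no
-- quantifiers. Replacing an atom by a constant keeps the index, so truth
-- can be defined through substitution by recursion on the index.

data QBF (X : Set) : ℕ → Set where
  atom           : ∀ {n} → X → QBF X n
  ⊤ᶠ ⊥ᶠ          : ∀ {n} → QBF X n
  ¬ᶠ_            : ∀ {n} → QBF X n → QBF X n
  _∧ᶠ_ _∨ᶠ_ _⊃ᶠ_ : ∀ {n} → QBF X n → QBF X n → QBF X n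
  ∀ᶠ ∃ᶠ          : ∀ {n} → X → QBF X n → QBF X (suc n)

embed : ∀ {X n} → Formula X → QBF X n
embed (atom p) = atom p
embed ⊤ᶠ       = ⊤ᶠ
embed ⊥ᶠ       = ⊥ᶠ
embed (¬ᶠ φ)   = ¬ᶠ embed φ
embed (φ ∧ᶠ ψ) = embed φ ∧ᶠ embed ψ
embed (φ ∨ᶠ ψ) = embed φ ∨ᶠ embed ψ
embed (φ ⊃ᶠ ψ) = embed φ ⊃ᶠ embed ψ

∃* : ∀ {X n} (P : List X) → QBF X n → QBF X (length P + n)
∃* []      Φ = Φ
∃* (p ∷ P) Φ = ∃ᶠ p (∃* P Φ)

constant : ∀ {X n} → Bool → QBF X n
constant true  = ⊤ᶠ
constant false = ⊥ᶠ

module QBFSemantics {X : Set} (_≟_ : DecidableEquality X) where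

  infix 10 _[_/_]
  infix 4  _⊨_

  _[_/_] : ∀ {n} → QBF X n → X → Bool → QBF X n
  atom q   [ p / c ] with q ≟ p
  ... | yes _ = constant c
  ... | no  _ = atom q
  ⊤ᶠ       [ p / c ] = ⊤ᶠ
  ⊥ᶠ       [ p / c ] = ⊥ᶠ
  (¬ᶠ Φ)   [ p / c ] = ¬ᶠ (Φ [ p / c ])
  (Φ ∧ᶠ Ψ) [ p / c ] = (Φ [ p / c ]) ∧ᶠ (Ψ [ p / c ])
  (Φ ∨ᶠ Ψ) [ p / c ] = (Φ [ p / c ]) ∨ᶠ (Ψ [ p / c ])
  (Φ ⊃ᶠ Ψ) [ p / c ] = (Φ [ p / c ]) ⊃ᶠ (Ψ [ p / c ])
  ∀ᶠ q Ψ   [ p / c ] with q ≟ p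
  ... | yes _ = ∀ᶠ q Ψ
  ... | no  _ = ∀ᶠ q (Ψ [ p / c ])
  ∃ᶠ q Ψ   [ p / c ] with q ≟ p
  ... | yes _ = ∃ᶠ q Ψ
  ... | no  _ = ∃ᶠ q (Ψ [ p / c ])

  -- Material implication is "false or true", not the function space: the
  -- two differ when I is not decidable, and the former is also the form
  -- of the clause for implication in here-and-there.
  _⊨_ : ∀ {n} → Pred X 0ℓ → QBF X n → Set
  I ⊨ atom p   = I p
  I ⊨ ⊤ᶠ       = ⊤
  I ⊨ ⊥ᶠ       = ⊥
  I ⊨ ¬ᶠ Φ     = ¬ (I ⊨ Φ)
  I ⊨ (Φ ∧ᶠ Ψ) = (I ⊨ Φ) × (I ⊨ Ψ)
  I ⊨ (Φ ∨ᶠ Ψ) = (I ⊨ Φ) ⊎ (I ⊨ Ψ)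
  I ⊨ (Φ ⊃ᶠ Ψ) = ¬ (I ⊨ Φ) ⊎ (I ⊨ Ψ)
  I ⊨ ∀ᶠ p Ψ   = (I ⊨ Ψ [ p / true ]) × (I ⊨ Ψ [ p / false ])
  I ⊨ ∃ᶠ p Ψ   = (I ⊨ Ψ [ p / true ]) ⊎ (I ⊨ Ψ [ p / false ])

⋀ : ∀ {X n} → Vec (Formula X) n → Formula X
⋀ = foldr′ _∧ᶠ_ ⊤ᶠ

infix 5 _≤ᶠ_ _<ᶠ_

_≤ᶠ_ : ∀ {X n} → Vec (Formula X) n → Vec (Formula X) n → Formula X
S ≤ᶠ T = ⋀ (zipWith _⊃ᶠ_ S T)

_<ᶠ_ : ∀ {X n} → Vec (Formula X) n → Vec (Formula X) n → Formula X
S <ᶠ T = (S ≤ᶠ T) ∧ᶠ ¬ᶠ (T ≤ᶠ S)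

------------------------------------------------------------------------
-- Here-and-there and equilibrium models

data World : Set where
  H T : World

infix 4 _≤ʷ_

data _≤ʷ_ : World → World → Set where
  ≤ʷ-refl : ∀ {w} → w ≤ʷ w
  H≤T     : H ≤ʷ T

record HTInterpretation (A : Set) : Set₁ where
  constructor ⟨_,_∣_⟩
  field
    I-H     : Pred A 0ℓ
    I-T     : Pred A 0ℓ
    I-H⊆I-T : I-H ⊆ I-T

  atomsAt : World → Pred A 0ℓ
  atomsAt H = I-H
  atomsAt T = I-T

open HTInterpretation public

infix 4 _,_⊨ʰᵗ_ _HTModelOf_ _EquilibriumModelOf_

_,_⊨ʰᵗ_ : ∀ {A} → HTInterpretation A → World → Formula A → Set
𝓘 , w ⊨ʰᵗ atom p   = atomsAt 𝓘 w p
𝓘 , w ⊨ʰᵗ ⊤ᶠ       = ⊤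
𝓘 , w ⊨ʰᵗ ⊥ᶠ       = ⊥
𝓘 , w ⊨ʰᵗ ¬ᶠ ψ     = ∀ u → w ≤ʷ u → ¬ (𝓘 , u ⊨ʰᵗ ψ)
𝓘 , w ⊨ʰᵗ (φ ∧ᶠ ψ) = (𝓘 , w ⊨ʰᵗ φ) × (𝓘 , w ⊨ʰᵗ ψ)
𝓘 , w ⊨ʰᵗ (φ ∨ᶠ ψ) = (𝓘 , w ⊨ʰᵗ φ) ⊎ (𝓘 , w ⊨ʰᵗ ψ)
𝓘 , w ⊨ʰᵗ (φ ⊃ᶠ ψ) = ∀ u → w ≤ʷ u → ¬ (𝓘 , u ⊨ʰᵗ φ) ⊎ (𝓘 , u ⊨ʰᵗ ψ)

_HTModelOf_ : ∀ {A} → HTInterpretation A → Formula A → Set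
𝓘 HTModelOf φ = 𝓘 , H ⊨ʰᵗ φ

-- "⟨ I , I ⟩ is an equilibrium model of φ".
_EquilibriumModelOf_ : ∀ {A} → Pred A 0ℓ → Formula A → Set₁
I EquilibriumModelOf φ =
  (⟨ I , I ∣ id ⟩ HTModelOf φ) ×
  (∀ J → (J⊂I : J ⊂ I) → ¬ (⟨ J , I ∣ proj₁ J⊂I ⟩ HTModelOf φ))

------------------------------------------------------------------------
-- Priming and the translations

-- Two disjoint copies of the atoms: inj₁ p is p itself, inj₂ p is p′.
Atom± : Set → Set
Atom± A = A ⊎ A

infix 10 _′ _′ˢ

_′ : ∀ {A} → Formula A → Formula (Atom± A)
atom p ′   = atom (inj₂ p)
⊤ᶠ ′       = ⊤ᶠ
⊥ᶠ ′       = ⊥ᶠ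
(¬ᶠ φ) ′   = ¬ᶠ (φ ′)
(φ ∧ᶠ ψ) ′ = (φ ′) ∧ᶠ (ψ ′)
(φ ∨ᶠ ψ) ′ = (φ ′) ∨ᶠ (ψ ′)
(φ ⊃ᶠ ψ) ′ = (φ ′) ⊃ᶠ (ψ ′)

_′ˢ : ∀ {A} → Pred A 0ℓ → Pred (Atom± A) 0ℓ
I ′ˢ = [ const ⊥ , I ]

τ[_] : ∀ {A} → Formula A → Formula (Atom± A)
τ[ atom p ]   = atom (inj₁ p)
τ[ ⊤ᶠ ]       = ⊤ᶠ
τ[ ⊥ᶠ ]       = ⊥ᶠ
τ[ ¬ᶠ ψ ]     = ¬ᶠ (ψ ′)
τ[ φ ∧ᶠ ψ ]   = τ[ φ ] ∧ᶠ τ[ ψ ]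
τ[ φ ∨ᶠ ψ ]   = τ[ φ ] ∨ᶠ τ[ ψ ]
τ[ φ ⊃ᶠ ψ ]   = (τ[ φ ] ⊃ᶠ τ[ ψ ]) ∧ᶠ (φ ′ ⊃ᶠ ψ ′)

occurrences : ∀ {A} → Formula A → List A
occurrences (atom p) = [ p ]
occurrences ⊤ᶠ       = []
occurrences ⊥ᶠ       = []
occurrences (¬ᶠ φ)   = occurrences φ
occurrences (φ ∧ᶠ ψ) = occurrences φ ++ occurrences ψ
occurrences (φ ∨ᶠ ψ) = occurrences φ ++ occurrences ψ
occurrences (φ ⊃ᶠ ψ) = occurrences φ ++ occurrences ψ

module Translation {A : Set} (_≟_ : DecidableEquality A) where

  open QBFSemantics (≡-dec _≟_ _≟_) public

  var : Formula A → List A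
  var φ = deduplicate _≟_ (occurrences φ)

  𝓣ᴱ[_] : (φ : Formula A) → QBF (Atom± A) (length (List.map inj₁ (var φ)) + 0)
  𝓣ᴱ[ φ ] = embed (φ ′) ∧ᶠ ¬ᶠ ∃* (List.map inj₁ V) (embed ((V⁰ <ᶠ V¹) ∧ᶠ τ[ φ ]))
    where
    V : List A
    V = var φ

    -- The atoms p of V and their primed versions p′, in the same order.
    V⁰ V¹ : Vec (Formula (Atom± A)) (length V)
    V⁰ = Vec.map (λ p → atom (inj₁ p)) (fromList V)
    V¹ = Vec.map (λ p → atom (inj₂ p)) (fromList V)

{-# OPTIONS --safe #-}
module Submission where

-- Why the theorem holds.
--
-- The formula under the quantifiers says, of an interpretation N of the
-- atoms p and p′, that the pair ⟨ J , I ⟩ read off from N is an HT-model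
-- of φ with J a proper subset of I. Indeed, if J is the set of p with p in
-- N and I the set of p with p′ in N, then φ ′ evaluates φ at world T of
-- ⟨ J , I ⟩ (prime-T), τ[ φ ] evaluates φ at world H (τ-H), and V < V′
-- says J ⊂ I for subsets of V (<ᶠ-⊂). The translation of a negation
-- mentions only world T, which suffices because truth persists from H to T
-- (persistence). At a total interpretation ⟨ I , I ⟩ the two worlds agree,
-- so that φ ′ also expresses that ⟨ I , I ⟩ is an HT-model of φ
-- (prime-total).
--
-- It remains to see that ∃ V ranges over all J. Truth of quantifiers is
-- defined through substitution of constants. The substitution lemma
-- (substitution) turns this into a change of the interpretation, and
-- iterating it (∃*-variant) shows that ∃* P Φ holds in M iff Φ holds in
-- some interpretation which agrees with M off P and is decidable on P.
--
-- Constructively, the sets I and J need not be decidable. For I nothing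
-- more is needed, since I is never quantified over and the implication
-- "not p′, or p" amounts to I p → J p as soon as J p is decidable. An
-- undecidable J appears only in the proof that no such J exists; there the
-- goal is a negation, and the decidability of J on the finite list V can
-- be assumed since its double negation is provable (¬¬-All-Dec).

open import Defs
open import Data.Bool.Base as Bool using (Bool; true; false; if_then_else_)
open import Data.Bool.Properties using (T?)
open import Data.Empty using (⊥; ⊥-elim)
open import Data.List.Base as List using (List; []; _∷_)
import Data.List.Membership.DecPropositional as DecMembership
open import Data.List.Membership.Propositional using (_∈_; _∉_)
open import Data.List.Membership.Propositional.Properties
  using (∈-map⁺; ∈-map⁻)
open import Data.List.Relation.Unary.All as All using (All; []; _∷_)
open import Data.List.Relation.Unary.Any using (here; there)
open import Data.Nat.Base using (suc; _+_)
open import Data.Product.Base as Product using (_×_; _,_; proj₁; ∃-syntax; Σ-syntax)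
open import Data.Product.Function.NonDependent.Propositional using (_×-cong_)
open import Data.Sum.Base as Sum using (_⊎_; inj₁; inj₂; [_,_])
open import Data.Sum.Function.Propositional using (_⊎-cong_)
open import Data.Sum.Properties using (≡-dec)
open import Data.Unit.Base using (⊤; tt)
import Data.Vec.Base as Vec
open import Function.Base using (id; _∘_; const)
open import Function.Bundles using (_⇔_; mk⇔; Equivalence)
open import Function.Construct.Composition using () renaming (_⇔-∘_ to infixr 8 _∘-⇔_)
open import Function.Construct.Identity using (⇔-id)
open import Function.Construct.Symmetry using (⇔-sym)
open import Function.Related.Propositional using (equivalence)
open import Function.Related.TypeIsomorphisms using (¬-cong-⇔)
open import Level using (0ℓ)
open import Relation.Binary.Definitions using (DecidableEquality)
open import Relation.Binary.PropositionalEquality.Core using (_≢_; refl)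
open import Relation.Nullary.Decidable.Core
  using (Dec; yes; no; does; map′; ¬¬-excluded-middle)
open import Relation.Nullary.Negation.Core using (¬_; contradiction)
open import Relation.Unary using (Pred; _⊆_; _⊂_)

open Equivalence using (to; from)

-- Connectives and equivalence

-- "Not P, or Q" is how implication is interpreted throughout.
⊃-cong-⇔ : {P Q R S : Set} → P ⇔ Q → R ⇔ S → (¬ P ⊎ R) ⇔ (¬ Q ⊎ S)
⊃-cong-⇔ P⇔Q R⇔S = _⊎-cong_ {k = equivalence} (¬-cong-⇔ P⇔Q) R⇔S

×-cong-⇔ : {P Q R S : Set} → P ⇔ Q → R ⇔ S → (P × R) ⇔ (Q × S)
×-cong-⇔ = _×-cong_ {k = equivalence}

⊎-cong-⇔ : {P Q R S : Set} → P ⇔ Q → R ⇔ S → (P ⊎ R) ⇔ (Q ⊎ S)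
⊎-cong-⇔ = _⊎-cong_ {k = equivalence}

⊃⇒→ : {P Q : Set} → ¬ P ⊎ Q → P → Q
⊃⇒→ (inj₁ ¬p) p = contradiction p ¬p
⊃⇒→ (inj₂ q)  _ = q

→⇒⊃-conclusion : {P Q : Set} → Dec Q → (P → Q) → ¬ P ⊎ Q
→⇒⊃-conclusion (yes q) _   = inj₂ q
→⇒⊃-conclusion (no ¬q) P→Q = inj₁ (¬q ∘ P→Q)

→⇒⊃-premise : {P Q : Set} → Dec P → (P → Q) → ¬ P ⊎ Q
→⇒⊃-premise (yes p) P→Q = inj₂ (P→Q p)
→⇒⊃-premise (no ¬p) _   = inj₁ ¬p

¬¬-All-Dec : {X : Set} (P : Pred X 0ℓ) (xs : List X) → ¬ ¬ All (Dec ∘ P) xs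
¬¬-All-Dec P []       k = k []
¬¬-All-Dec P (x ∷ xs) k =
  ¬¬-excluded-middle λ d → ¬¬-All-Dec P xs λ ds → k (d ∷ ds)

-- Quantifiers over atoms as changes of the interpretation

module Quantifiers {X : Set} (_≟_ : DecidableEquality X) where

  open QBFSemantics _≟_

  infix 10 _[_≔_]
  infix 4  _≈_

  -- Interpretations that contain the same atoms.
  _≈_ : Pred X 0ℓ → Pred X 0ℓ → Set
  M ≈ N = ∀ x → M x ⇔ N x

  -- M with the truth value of the atom p changed to c.
  _[_≔_] : Pred X 0ℓ → X → Bool → Pred X 0ℓ
  (M [ p ≔ c ]) q = if does (q ≟ p) then Bool.T c else M q

  constant-⇔ : ∀ {n M} c → (M ⊨ constant {n = n} c) ⇔ Bool.T c
  constant-⇔ true  = ⇔-id ⊤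
  constant-⇔ false = ⇔-id ⊥

  ≔-at : ∀ M p c → (M [ p ≔ c ]) p ⇔ Bool.T c
  ≔-at M p c with p ≟ p
  ... | yes _  = ⇔-id _
  ... | no p≢p = contradiction refl p≢p

  ≔-off : ∀ M {p q} c → q ≢ p → (M [ p ≔ c ]) q ⇔ M q
  ≔-off M {p} {q} c q≢p with q ≟ p
  ... | yes q≡p = contradiction q≡p q≢p
  ... | no _    = ⇔-id _

  ≔-cong : ∀ {M N} p c → M ≈ N → M [ p ≔ c ] ≈ N [ p ≔ c ]
  ≔-cong p c M≈N q with q ≟ p
  ... | yes _ = ⇔-id _
  ... | no  _ = M≈N q

  ≔-overwrite : ∀ M p c d → M [ p ≔ d ] ≈ M [ p ≔ c ] [ p ≔ d ]
  ≔-overwrite M p c d q with q ≟ p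
  ... | yes _ = ⇔-id _
  ... | no  _ = ⇔-id _

  ≔-comm : ∀ M {p q} c d → q ≢ p →
           M [ q ≔ d ] [ p ≔ c ] ≈ M [ p ≔ c ] [ q ≔ d ]
  ≔-comm M {p} {q} c d q≢p r with r ≟ p | r ≟ q
  ... | yes refl | yes refl = contradiction refl q≢p
  ... | yes _    | no _     = ⇔-id _
  ... | no _     | yes _    = ⇔-id _
  ... | no _     | no _     = ⇔-id _

  ⊨-resp-≈ : ∀ {n M N} → M ≈ N → (Φ : QBF X n) → (M ⊨ Φ) ⇔ (N ⊨ Φ)
  ⊨-resp-≈ M≈N (atom p) = M≈N p
  ⊨-resp-≈ M≈N ⊤ᶠ       = ⇔-id _
  ⊨-resp-≈ M≈N ⊥ᶠ       = ⇔-id _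
  ⊨-resp-≈ M≈N (¬ᶠ Φ)   = ¬-cong-⇔ (⊨-resp-≈ M≈N Φ)
  ⊨-resp-≈ M≈N (Φ ∧ᶠ Ψ) = ×-cong-⇔ (⊨-resp-≈ M≈N Φ) (⊨-resp-≈ M≈N Ψ)
  ⊨-resp-≈ M≈N (Φ ∨ᶠ Ψ) = ⊎-cong-⇔ (⊨-resp-≈ M≈N Φ) (⊨-resp-≈ M≈N Ψ)
  ⊨-resp-≈ M≈N (Φ ⊃ᶠ Ψ) = ⊃-cong-⇔ (⊨-resp-≈ M≈N Φ) (⊨-resp-≈ M≈N Ψ)
  ⊨-resp-≈ {suc n} M≈N (∀ᶠ p Ψ) =
    ×-cong-⇔ (⊨-resp-≈ {n} M≈N (Ψ [ p / true ]))
             (⊨-resp-≈ {n} M≈N (Ψ [ p / false ]))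
  ⊨-resp-≈ {suc n} M≈N (∃ᶠ p Ψ) =
    ⊎-cong-⇔ (⊨-resp-≈ {n} M≈N (Ψ [ p / true ]))
             (⊨-resp-≈ {n} M≈N (Ψ [ p / false ]))

  -- The two auxiliary lemmas treat the body of a quantifier that binds p
  -- and of one that binds another atom q. The recursion is on the quantifier
  -- depth, then on the formula: M ⊨ Ψ [ p / c ] [ q / d ] needs the lemma
  -- for Ψ [ p / c ], which is not a subformula but has the depth of Ψ.
  mutual

    substitution : ∀ {n} M (Φ : QBF X n) p c →
                   (M ⊨ Φ [ p / c ]) ⇔ (M [ p ≔ c ] ⊨ Φ)
    substitution {n} M (atom q) p c with q ≟ p
    ... | yes _ = constant-⇔ {n} {M} c
    ... | no  _ = ⇔-id _
    substitution M ⊤ᶠ       p c = ⇔-id _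
    substitution M ⊥ᶠ       p c = ⇔-id _
    substitution M (¬ᶠ Φ)   p c = ¬-cong-⇔ (substitution M Φ p c)
    substitution M (Φ ∧ᶠ Ψ) p c =
      ×-cong-⇔ (substitution M Φ p c) (substitution M Ψ p c)
    substitution M (Φ ∨ᶠ Ψ) p c =
      ⊎-cong-⇔ (substitution M Φ p c) (substitution M Ψ p c)
    substitution M (Φ ⊃ᶠ Ψ) p c =
      ⊃-cong-⇔ (substitution M Φ p c) (substitution M Ψ p c)
    substitution {suc n} M (∀ᶠ q Ψ) p c with q ≟ p
    ... | yes refl = ×-cong-⇔ (substitution-bound {n} M Ψ q c true)
                              (substitution-bound {n} M Ψ q c false)
    ... | no q≢p   = ×-cong-⇔ (substitution-free {n} M Ψ c true q≢p)
                              (substitution-free {n} M Ψ c false q≢p)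
    substitution {suc n} M (∃ᶠ q Ψ) p c with q ≟ p
    ... | yes refl = ⊎-cong-⇔ (substitution-bound {n} M Ψ q c true)
                              (substitution-bound {n} M Ψ q c false)
    ... | no q≢p   = ⊎-cong-⇔ (substitution-free {n} M Ψ c true q≢p)
                              (substitution-free {n} M Ψ c false q≢p)

    -- The value of p is irrelevant where p is bound, that is, about to be
    -- replaced by d.
    substitution-bound : ∀ {n} M (Ψ : QBF X n) p c d →
                         (M ⊨ Ψ [ p / d ]) ⇔ (M [ p ≔ c ] ⊨ Ψ [ p / d ])
    substitution-bound M Ψ p c d =
      ⇔-sym (substitution (M [ p ≔ c ]) Ψ p d)
      ∘-⇔ ⊨-resp-≈ (≔-overwrite M p c d) Ψ
      ∘-⇔ substitution M Ψ p d

    substitution-free : ∀ {n} M (Ψ : QBF X n) {p q} c d → q ≢ p →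
                        (M ⊨ Ψ [ p / c ] [ q / d ]) ⇔
                        (M [ p ≔ c ] ⊨ Ψ [ q / d ])
    substitution-free M Ψ {p} {q} c d q≢p =
      ⇔-sym (substitution (M [ p ≔ c ]) Ψ q d)
      ∘-⇔ ⊨-resp-≈ (≔-comm M c d q≢p) Ψ
      ∘-⇔ substitution (M [ q ≔ d ]) Ψ p c
      ∘-⇔ substitution M (Ψ [ p / c ]) q d

  -- N is obtained from M by choosing truth values for the atoms in P.
  -- Decidability on P stands for the choice of Boolean values.
  record Variant (P : List X) (M N : Pred X 0ℓ) : Set where
    field
      decidable : ∀ {q} → q ∈ P → Dec (N q)
      agree     : ∀ {q} → q ∉ P → N q ⇔ M q

  open Variant public

  variant-∷⁺ : ∀ {p P M N} c → Variant P (M [ p ≔ c ]) N → Variant (p ∷ P) M N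
  variant-∷⁺ {p} {P} {M} {N} c v = record
    { decidable = λ where
        -- The head p may occur again in P, and then the later choice counts.
        (here refl) → decidable-p (p ∈? P)
        (there q∈P) → decidable v q∈P
    ; agree = λ q∉ → ≔-off M c (q∉ ∘ here) ∘-⇔ agree v (q∉ ∘ there)
    }
    where
    open DecMembership _≟_ using (_∈?_)

    decidable-p : Dec (p ∈ P) → Dec (N p)
    decidable-p (yes p∈P) = decidable v p∈P
    decidable-p (no p∉P)  = map′ (from Np⇔c) (to Np⇔c) (T? c)
      where Np⇔c = ≔-at M p c ∘-⇔ agree v p∉P

  variant-∷⁻ : ∀ {p P M N} → Variant (p ∷ P) M N →
               ∃[ c ] Variant P (M [ p ≔ c ]) N
  variant-∷⁻ {p} {P} {M} {N} v = does Np? , record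
    { decidable = decidable v ∘ there
    ; agree     = agree′
    }
    where
    Np? : Dec (N p)
    Np? = decidable v (here refl)

    truth-value : {B : Set} (B? : Dec B) → B ⇔ Bool.T (does B?)
    truth-value (yes b) = mk⇔ (const tt) (const b)
    truth-value (no ¬b) = mk⇔ ¬b ⊥-elim

    agree′ : ∀ {q} → q ∉ P → N q ⇔ (M [ p ≔ does Np? ]) q
    agree′ {q} q∉P with q ≟ p
    ... | yes refl = truth-value Np?
    ... | no q≢p   = agree v λ where
      (here q≡p)  → q≢p q≡p
      (there q∈P) → q∉P q∈P

  ∃*-variant : ∀ {n} M P (Φ : QBF X n) →
               (M ⊨ ∃* P Φ) ⇔ (∃[ N ] Variant P M N × (N ⊨ Φ))
  ∃*-variant M [] Φ = mk⇔
    (λ M⊨Φ → M , record { decidable = λ () ; agree = λ _ → ⇔-id _ } , M⊨Φ)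
    (λ (N , v , N⊨Φ) → to (⊨-resp-≈ (λ x → agree v λ ()) Φ) N⊨Φ)
  ∃*-variant M (p ∷ P) Φ = mk⇔
    [ forward true , forward false ]
    (λ (N , v , N⊨Φ) →
      let (c , v′) = variant-∷⁻ v in
      backward c (from (∃*-variant (M [ p ≔ c ]) P Φ) (N , v′ , N⊨Φ)))
    where
    forward : ∀ c → M ⊨ (∃* P Φ) [ p / c ] →
              ∃[ N ] Variant (p ∷ P) M N × (N ⊨ Φ)
    forward c M⊨ =
      Product.map₂ (Product.map₁ (variant-∷⁺ c))
        (to (∃*-variant (M [ p ≔ c ]) P Φ) (to (substitution M (∃* P Φ) p c) M⊨))

    backward : ∀ c → M [ p ≔ c ] ⊨ ∃* P Φ → M ⊨ ∃ᶠ p (∃* P Φ)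
    backward true  M⊨ = inj₁ (from (substitution M (∃* P Φ) p true) M⊨)
    backward false M⊨ = inj₂ (from (substitution M (∃* P Φ) p false) M⊨)

-- Here-and-there

≤ʷ-trans : ∀ {u v w} → u ≤ʷ v → v ≤ʷ w → u ≤ʷ w
≤ʷ-trans ≤ʷ-refl v≤w     = v≤w
≤ʷ-trans H≤T     ≤ʷ-refl = H≤T

≤ʷ-T : ∀ w → w ≤ʷ T
≤ʷ-T H = H≤T
≤ʷ-T T = ≤ʷ-refl

persistence : {A : Set} (𝓘 : HTInterpretation A) (φ : Formula A) →
              ∀ {u w} → u ≤ʷ w → 𝓘 , u ⊨ʰᵗ φ → 𝓘 , w ⊨ʰᵗ φ
persistence 𝓘 (atom p) ≤ʷ-refl = id
persistence 𝓘 (atom p) H≤T     = I-H⊆I-T 𝓘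
persistence 𝓘 ⊤ᶠ       u≤w     = id
persistence 𝓘 ⊥ᶠ       u≤w     = id
persistence 𝓘 (¬ᶠ φ)   u≤w ¬φ  = λ v w≤v → ¬φ v (≤ʷ-trans u≤w w≤v)
persistence 𝓘 (φ ∧ᶠ ψ) u≤w =
  Product.map (persistence 𝓘 φ u≤w) (persistence 𝓘 ψ u≤w)
persistence 𝓘 (φ ∨ᶠ ψ) u≤w =
  Sum.map (persistence 𝓘 φ u≤w) (persistence 𝓘 ψ u≤w)
persistence 𝓘 (φ ⊃ᶠ ψ) u≤w φ⊃ψ = λ v w≤v → φ⊃ψ v (≤ʷ-trans u≤w w≤v)

-- A world at which, and hence above which, 𝓘 is classical.
Total : {A : Set} → HTInterpretation A → World → Set
Total 𝓘 w = I-T 𝓘 ⊆ atomsAt 𝓘 w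

total-↑ : {A : Set} (𝓘 : HTInterpretation A) →
          ∀ {u w} → u ≤ʷ w → Total 𝓘 u → Total 𝓘 w
total-↑ 𝓘 ≤ʷ-refl total = total
total-↑ 𝓘 H≤T     _     = id

-- Truth of the translations

module _ {A : Set} (_≟_ : DecidableEquality A) where

  open Translation _≟_
  open Quantifiers (≡-dec _≟_ _≟_) using (∃*-variant; decidable; agree)

  -- Where 𝓘 is classical, truth is classical truth in I-T, which φ ′
  -- expresses about the primed atoms.
  prime-total : ∀ {n} {N : Pred (Atom± A) 0ℓ} (𝓘 : HTInterpretation A) →
                (∀ p → N (inj₂ p) ⇔ I-T 𝓘 p) →
                (φ : Formula A) → ∀ {w} → Total 𝓘 w →
                (N ⊨ embed {n = n} (φ ′)) ⇔ (𝓘 , w ⊨ʰᵗ φ)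
  prime-total {n} {N} 𝓘 N′⇔ = go
    where
    atomsAt⊆I-T : ∀ w → atomsAt 𝓘 w ⊆ I-T 𝓘
    atomsAt⊆I-T H = I-H⊆I-T 𝓘
    atomsAt⊆I-T T = id

    go : (φ : Formula A) → ∀ {w} → Total 𝓘 w →
         (N ⊨ embed {n = n} (φ ′)) ⇔ (𝓘 , w ⊨ʰᵗ φ)
    go (atom p) {w} t = mk⇔ t (atomsAt⊆I-T w) ∘-⇔ N′⇔ p
    go ⊤ᶠ t = ⇔-id _
    go ⊥ᶠ t = ⇔-id _
    go (¬ᶠ φ) {w} t = mk⇔
      (λ ¬φ′ u w≤u → ¬φ′ ∘ from (go φ (total-↑ 𝓘 w≤u t)))
      (λ ¬φ → ¬φ w ≤ʷ-refl ∘ to (go φ t))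
    go (φ ∧ᶠ ψ) t = ×-cong-⇔ (go φ t) (go ψ t)
    go (φ ∨ᶠ ψ) t = ⊎-cong-⇔ (go φ t) (go ψ t)
    go (φ ⊃ᶠ ψ) {w} t = mk⇔
      (λ φ′⊃ψ′ u w≤u → let t′ = total-↑ 𝓘 w≤u t in
        to (⊃-cong-⇔ (go φ t′) (go ψ t′)) φ′⊃ψ′)
      (λ φ⊃ψ → from (⊃-cong-⇔ (go φ t) (go ψ t)) (φ⊃ψ w ≤ʷ-refl))

  prime-T : ∀ {n} {N : Pred (Atom± A) 0ℓ} (𝓘 : HTInterpretation A) →
            (∀ p → N (inj₂ p) ⇔ I-T 𝓘 p) → (φ : Formula A) →
            (N ⊨ embed {n = n} (φ ′)) ⇔ (𝓘 , T ⊨ʰᵗ φ)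
  prime-T 𝓘 N′⇔ φ = prime-total 𝓘 N′⇔ φ id

  τ-H : ∀ {n} {N : Pred (Atom± A) 0ℓ} (𝓘 : HTInterpretation A) →
        (∀ p → N (inj₁ p) ⇔ I-H 𝓘 p) → (∀ p → N (inj₂ p) ⇔ I-T 𝓘 p) →
        (φ : Formula A) →
        (N ⊨ embed {n = n} τ[ φ ]) ⇔ (𝓘 HTModelOf φ)
  τ-H {n} {N} 𝓘 N⇔ N′⇔ = go
    where
    T-go : (φ : Formula A) → (N ⊨ embed {n = n} (φ ′)) ⇔ (𝓘 , T ⊨ʰᵗ φ)
    T-go = prime-T 𝓘 N′⇔

    go : (φ : Formula A) → (N ⊨ embed {n = n} τ[ φ ]) ⇔ (𝓘 HTModelOf φ)
    go (atom p) = N⇔ p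
    go ⊤ᶠ       = ⇔-id _
    go ⊥ᶠ       = ⇔-id _
    -- By persistence, a formula that is false at T is false at H as well.
    go (¬ᶠ φ)   = mk⇔
      (λ ¬φ′ u _ → ¬φ′ ∘ from (T-go φ) ∘ persistence 𝓘 φ (≤ʷ-T u))
      (λ ¬φ → ¬φ T H≤T ∘ to (T-go φ))
    go (φ ∧ᶠ ψ) = ×-cong-⇔ (go φ) (go ψ)
    go (φ ∨ᶠ ψ) = ⊎-cong-⇔ (go φ) (go ψ)
    go (φ ⊃ᶠ ψ) = mk⇔
      (λ (at-H , at-T) → λ where
        H _ → to (⊃-cong-⇔ (go φ) (go ψ)) at-H
        T _ → to (⊃-cong-⇔ (T-go φ) (T-go ψ)) at-T)
      (λ φ⊃ψ → from (⊃-cong-⇔ (go φ) (go ψ)) (φ⊃ψ H ≤ʷ-refl)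
             , from (⊃-cong-⇔ (T-go φ) (T-go ψ)) (φ⊃ψ T H≤T))

  -- The list of atoms f p, for p in V, as it enters ≤ᶠ and <ᶠ.
  atoms : (A → Atom± A) → (V : List A) → Vec.Vec (Formula (Atom± A)) (List.length V)
  atoms f V = Vec.map (λ p → atom (f p)) (Vec.fromList V)

  ≤ᶠ-All : ∀ {n} {N : Pred (Atom± A) 0ℓ} (f g : A → Atom± A) (V : List A) →
           (N ⊨ embed {n = n} (atoms f V ≤ᶠ atoms g V)) ⇔
           All (λ p → ¬ N (f p) ⊎ N (g p)) V
  ≤ᶠ-All f g []      = mk⇔ (λ _ → []) (λ _ → tt)
  ≤ᶠ-All f g (p ∷ V) = mk⇔
    (λ (x , xs) → x ∷ to (≤ᶠ-All f g V) xs)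
    (λ { (x ∷ xs) → x , from (≤ᶠ-All f g V) xs })

  -- Decidability of J makes the two readings of implication agree: J p is
  -- the premise in J ⊆ I and the conclusion in I ⊆ J.
  <ᶠ-⊂ : ∀ {n} {N : Pred (Atom± A) 0ℓ} {I J : Pred A 0ℓ} {V : List A} →
         (∀ p → N (inj₁ p) ⇔ J p) → (∀ p → N (inj₂ p) ⇔ I p) →
         J ⊆ (_∈ V) → I ⊆ (_∈ V) → (∀ {p} → p ∈ V → Dec (J p)) →
         (N ⊨ embed {n = n} (atoms inj₁ V <ᶠ atoms inj₂ V)) ⇔ (J ⊂ I)
  <ᶠ-⊂ {n} {N} {I} {J} {V} N⇔ N′⇔ J⊆V I⊆V J? =
    ×-cong-⇔ ≤⇔⊆ (¬-cong-⇔ ≥⇔⊇)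
    where
    ≤⇔⊆ : (N ⊨ embed {n = n} (atoms inj₁ V ≤ᶠ atoms inj₂ V)) ⇔ (J ⊆ I)
    ≤⇔⊆ = mk⇔
      (λ J⊃I {p} Jp →
        ⊃⇒→ (to (⊃-cong-⇔ (N⇔ p) (N′⇔ p)) (All.lookup J⊃I (J⊆V Jp))) Jp)
      (λ J⊆I → All.tabulate λ {p} p∈V →
        from (⊃-cong-⇔ (N⇔ p) (N′⇔ p)) (→⇒⊃-premise (J? p∈V) J⊆I))
      ∘-⇔ ≤ᶠ-All inj₁ inj₂ V

    ≥⇔⊇ : (N ⊨ embed {n = n} (atoms inj₂ V ≤ᶠ atoms inj₁ V)) ⇔ (I ⊆ J)
    ≥⇔⊇ = mk⇔
      (λ I⊃J {p} Ip →
        ⊃⇒→ (to (⊃-cong-⇔ (N′⇔ p) (N⇔ p)) (All.lookup I⊃J (I⊆V Ip))) Ip)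
      (λ I⊆J → All.tabulate λ {p} p∈V →
        from (⊃-cong-⇔ (N′⇔ p) (N⇔ p)) (→⇒⊃-conclusion (J? p∈V) I⊆J))
      ∘-⇔ ≤ᶠ-All inj₂ inj₁ V

  -- The quantified part of 𝓣ᴱ[ φ ], with the list V arbitrary.
  smaller-model : (V : List A) → Formula A →
                  QBF (Atom± A) (List.length (List.map inj₁ V) + 0)
  smaller-model V φ =
    ∃* {n = 0} (List.map inj₁ V) (embed ((atoms inj₁ V <ᶠ atoms inj₂ V) ∧ᶠ τ[ φ ]))

  module _ (φ : Formula A) (I : Pred A 0ℓ) {V : List A} (I⊆V : I ⊆ (_∈ V)) where

    open DecMembership _≟_ using (_∈?_)

    smaller-model-sound : I ′ˢ ⊨ smaller-model V φ →
      Σ[ J ∈ Pred A 0ℓ ] Σ[ J⊂I ∈ J ⊂ I ] (⟨ J , I ∣ proj₁ J⊂I ⟩ HTModelOf φ)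
    smaller-model-sound I′⊨ with to (∃*-variant _ (List.map inj₁ V) _) I′⊨
    ... | N , v , N⊨< , N⊨τ = J , J⊂I , to (τ-H _ (λ _ → ⇔-id _) N′⇔I φ) N⊨τ
      where
      J : Pred A 0ℓ
      J p = N (inj₁ p)

      N′⇔I : ∀ p → N (inj₂ p) ⇔ I p
      N′⇔I p = agree v p′∉map
        where
        p′∉map : inj₂ p ∉ List.map inj₁ V
        p′∉map p′∈map with ∈-map⁻ inj₁ p′∈map
        ... | _ , _ , ()

      -- I ′ˢ contains no unprimed atom, so J gains atoms only from V.
      J⊆V : J ⊆ (_∈ V)
      J⊆V {p} Jp with p ∈? V
      ... | yes p∈V = p∈V
      ... | no p∉V  = ⊥-elim (to (agree v p∉map) Jp)
        where
        p∉map : inj₁ p ∉ List.map inj₁ V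
        p∉map p∈map with ∈-map⁻ inj₁ p∈map
        ... | _ , p∈V , refl = p∉V p∈V

      J⊂I : J ⊂ I
      J⊂I = to (<ᶠ-⊂ (λ _ → ⇔-id _) N′⇔I J⊆V I⊆V (decidable v ∘ ∈-map⁺ inj₁)) N⊨<

    -- Only a decidable J can be chosen by the quantifiers.
    smaller-model-complete : ∀ J (J⊂I : J ⊂ I) → (∀ {p} → p ∈ V → Dec (J p)) →
      ⟨ J , I ∣ proj₁ J⊂I ⟩ HTModelOf φ → I ′ˢ ⊨ smaller-model V φ
    smaller-model-complete J J⊂I J? ⊨φ =
      from (∃*-variant _ (List.map inj₁ V) _)
        ( N
        , record { decidable = dec ; agree = off }
        , from (<ᶠ-⊂ (λ _ → ⇔-id _) (λ _ → ⇔-id _) (I⊆V ∘ proj₁ J⊂I) I⊆V J?) J⊂I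
        , from (τ-H _ (λ _ → ⇔-id _) (λ _ → ⇔-id _) φ) ⊨φ
        )
      where
      N : Pred (Atom± A) 0ℓ
      N = [ J , I ]

      dec : ∀ {q} → q ∈ List.map inj₁ V → Dec (N q)
      dec q∈ with ∈-map⁻ inj₁ q∈
      ... | _ , p∈V , refl = J? p∈V

      off : ∀ {q} → q ∉ List.map inj₁ V → N q ⇔ (I ′ˢ) q
      off {inj₁ p} p∉ = mk⇔ (p∉ ∘ ∈-map⁺ inj₁ ∘ I⊆V ∘ proj₁ J⊂I) ⊥-elim
      off {inj₂ p} _  = ⇔-id _

theorem1 : (A : Set) (_≟_ : DecidableEquality A) →
    let open Translation _≟_ in
    (φ : Formula A) (I : Pred A 0ℓ) →
    I ⊆ (_∈ var φ) →
    (I EquilibriumModelOf φ) ⇔ (I ′ˢ ⊨ 𝓣ᴱ[ φ ])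
theorem1 A _≟_ φ I I⊆V = mk⇔
  (λ (I⊨φ , minimal) →
      from I′⊨φ′⇔ I⊨φ
    , λ smaller → let (J , J⊂I , J⊨φ) = smaller-model-sound _≟_ φ I I⊆V smaller in
                  minimal J J⊂I J⊨φ)
  (λ (I′⊨φ′ , ¬smaller) →
      to I′⊨φ′⇔ I′⊨φ′
    -- The goal is ⊥ here, so J may be taken to be decidable on var φ.
    , λ J J⊂I J⊨φ → ¬¬-All-Dec J (var φ) λ J? →
        ¬smaller (smaller-model-complete _≟_ φ I I⊆V J J⊂I (All.lookup J?) J⊨φ))
  where
  open Translation _≟_

  I′⊨φ′⇔ : (I ′ˢ ⊨ embed (φ ′)) ⇔ (⟨ I , I ∣ id ⟩ HTModelOf φ)
  I′⊨φ′⇔ = prime-total _≟_ ⟨ I , I ∣ id ⟩ (λ _ → ⇔-id _) φ id
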